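{- Let $z$ be an integer with $z>2$. The density $\rho$ of the graph $G_t^z$ (a function of $t$) satisfies $\rho\to 0$ as $t\to\infty$.
   Context: Fix an integer $z>2$. The finite simple graphs $G_t^z$ ($t=0,1,2,\dots$), each with a distinguished vertex called its root (its largest, original hub node) and a distinguished set of vertices called its last-layer bottom nodes, are defined recursively. $G_0^z$ is a triangle; one of its vertices is the root (hub node) and the other two are its (last-layer) bottom nodes. For $t\ge1$, $G_t^z$ is formed from the disjoint union of $z$ copies of $G_{t-1}^z$, one called the original and the other $z-1$ called replicas, by adding an edge from the root of the original copy to every last-layer bottom node of each of the $z-1$ replicas. The root of $G_t^z$ is the root of the original copy, and the last-layer bottom nodes of $G_t^z$ are the last-layer bottom nodes of all $z-1$ replicas. The density of a graph with $N$ vertices and $E$ edges is $\rho=\frac{2E}{N(N-1)}$. -}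

module Defs where

open import Data.Nat.Base as ℕ using (ℕ; zero; suc; 2+; NonZero; NonTrivial; _*_; _∸_; s≤s; z≤n)
import Data.Nat.Properties as ℕ
open import Data.Integer.Base using (+_)
open import Data.Rational.Base as ℚ using (ℚ; 0ℚ; _/_)
open import Data.Fin.Base as Fin using (Fin; zero; fromℕ<; remQuot; combine)
import Data.Fin.Properties as Fin
open import Data.List.Base using (length; filter; allFin; cartesianProduct)
open import Data.Product.Base using (_×_; _,_; ∃)
open import Data.Sum.Base using (_⊎_; inj₁; inj₂; map) renaming (swap to ⊎-swap)
open import Function.Base using (_∘_)
open import Level using (0ℓ)
open import Relation.Binary.Core using (Rel)
open import Relation.Binary.Definitions as B using (Symmetric)
open import Relation.Binary.PropositionalEquality.Core using (_≡_; _≢_; refl; sym; ≢-sym)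
open import Relation.Nullary.Decidable using (¬?; _×-dec_; _⊎-dec_)
open import Relation.Nullary.Negation using (¬_)
open import Relation.Unary as U using (Pred)

record Graph : Set₁ where
  field
    order  : ℕ
    Adj    : Rel (Fin order) 0ℓ
    adj?   : B.Decidable Adj
    symm   : Symmetric Adj
    irrefl : ∀ {v} → ¬ Adj v v

  -- Each edge {i , j} is counted once, as the pair with i < j.
  size : ℕ
  size = length (filter (λ (i , j) → (i Fin.<? j) ×-dec adj? i j)
                        (cartesianProduct (allFin order) (allFin order)))

n[n∸1]≢0 : ∀ n → .{{NonTrivial n}} → NonZero (n * (n ∸ 1))
n[n∸1]≢0 (2+ _) = _

density : (g : Graph) → .{{NonTrivial (Graph.order g)}} → ℚ
density g = _/_ (+ (2 * size)) (order * (order ∸ 1)) {{n[n∸1]≢0 order}}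
  where open Graph g

record HubGraph : Set₁ where
  field
    graph   : Graph
  open Graph graph public
  field
    root    : Fin order
    Bottom  : Pred (Fin order) 0ℓ
    bottom? : U.Decidable Bottom

triangle : HubGraph
triangle = record
  { graph   = record
    { order  = 3
    ; Adj    = _≢_
    ; adj?   = λ u v → ¬? (u Fin.≟ v)
    ; symm   = ≢-sym
    ; irrefl = λ v≢v → v≢v refl
    }
  ; root    = zero
  ; Bottom  = _≢ zero
  ; bottom? = λ v → ¬? (v Fin.≟ zero)
  }

-- One step of the construction: k copies of h, the copy with index o being the
-- original and the others its replicas. The vertex (c , v) is the copy of v in
-- copy c; Fin k × Fin order is numbered by Fin (k * order) via remQuot/combine.
module Step (k : ℕ) (o : Fin k) (h : HubGraph) where
  open HubGraph h

  Copies : Set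
  Copies = Fin k × Fin order

  Within : Rel Copies 0ℓ
  Within (c , u) (d , v) = c ≡ d × Adj u v

  ReplicaBottom : Pred Copies 0ℓ
  ReplicaBottom (d , v) = d ≢ o × Bottom v

  HubTo : Rel Copies 0ℓ
  HubTo (c , u) q = (c ≡ o × u ≡ root) × ReplicaBottom q

  StepAdj : Rel Copies 0ℓ
  StepAdj p q = Within p q ⊎ (HubTo p q ⊎ HubTo q p)

  within? : B.Decidable Within
  within? (c , u) (d , v) = (c Fin.≟ d) ×-dec adj? u v

  replicaBottom? : U.Decidable ReplicaBottom
  replicaBottom? (d , v) = ¬? (d Fin.≟ o) ×-dec bottom? v

  hubTo? : B.Decidable HubTo
  hubTo? (c , u) q = ((c Fin.≟ o) ×-dec (u Fin.≟ root)) ×-dec replicaBottom? q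

  stepAdj? : B.Decidable StepAdj
  stepAdj? p q = within? p q ⊎-dec (hubTo? p q ⊎-dec hubTo? q p)

  stepAdj-sym : Symmetric StepAdj
  stepAdj-sym = map (λ (c≡d , uv) → sym c≡d , symm uv) ⊎-swap

  stepAdj-irrefl : ∀ {p} → ¬ StepAdj p p
  stepAdj-irrefl (inj₁ (_ , vv))                               = irrefl vv
  stepAdj-irrefl (inj₂ (inj₁ ((c≡o , _) , (c≢o , _)))) = c≢o c≡o
  stepAdj-irrefl (inj₂ (inj₂ ((c≡o , _) , (c≢o , _)))) = c≢o c≡o

  vertex : Fin (k * order) → Copies
  vertex = remQuot order

  step : HubGraph
  step = record
    { graph   = record
      { order  = k * order
      ; Adj    = λ x y → StepAdj (vertex x) (vertex y)
      ; adj?   = λ x y → stepAdj? (vertex x) (vertex y)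
      ; symm   = stepAdj-sym
      ; irrefl = stepAdj-irrefl
      }
    ; root    = combine o root
    ; Bottom  = ReplicaBottom ∘ vertex
    ; bottom? = replicaBottom? ∘ vertex
    }

open Step public using (step)

module _ {z : ℕ} (z>2 : z ℕ.> 2) where

  z>0 : z ℕ.> 0
  z>0 = ℕ.≤-trans (s≤s z≤n) z>2

  G : ℕ → HubGraph
  G zero    = triangle
  G (suc t) = step z (fromℕ< z>0) (G t)

  order-G>1 : ∀ t → HubGraph.order (G t) ℕ.> 1
  order-G>1 zero    = s≤s (s≤s z≤n)
  order-G>1 (suc t) = ℕ.≤-trans (order-G>1 t) (ℕ.m≤n*m _ z {{ℕ.>-nonZero z>0}})

  ρ : ℕ → ℚ
  ρ t = density (HubGraph.graph (G t)) {{ℕ.n>1⇒nonTrivial (order-G>1 t)}}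

-- ε ranges over the positive rationals, which is equivalent to letting it
-- range over the positive reals.
infix 4 _⟶_
_⟶_ : (ℕ → ℚ) → ℚ → Set
a ⟶ ℓ = ∀ ε → ε ℚ.> 0ℚ → ∃ λ T → ∀ t → t ℕ.≥ T → ℚ.∣ a t ℚ.- ℓ ∣ ℚ.< ε

{-# OPTIONS --safe #-}
-- Every edge added at some step joins the hub of the original copy to a vertex
-- of a replica; charge it to the latter. A vertex is charged at most once per
-- step, and the triangle is oriented as a cycle, so G t has at most (1 + t) N
-- edges, N being its order. Hence ρ t ≤ 2 (1 + t) / (N - 1), which tends to 0
-- since N = 3 zᵗ grows exponentially.
module Submission where

open import Defs
open import Data.Nat.Base using (ℕ; _>_)
open import Data.Rational.Base using (0ℚ)

open import Data.Fin.Base as Fin using (Fin; zero; suc; combine; remQuot; fromℕ<)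
import Data.Fin.Properties as Fin
open import Data.Integer.Base as ℤ using (+_; +<+)
import Data.Integer.Properties as ℤ
open import Data.List.Base using (List; _∷_; length; lookup; filter; allFin; cartesianProduct)
open import Data.List.Membership.Propositional using (_∈_)
open import Data.List.Membership.Propositional.Properties using (∈-lookup; ∈-filter⁻)
import Data.List.Relation.Unary.All as All
open import Data.List.Relation.Unary.AllPairs using (_∷_)
open import Data.List.Relation.Unary.Unique.Propositional using (Unique)
import Data.List.Relation.Unary.Unique.Propositional.Properties as Unique
open import Data.Nat.Base
  using (zero; suc; _+_; _*_; _∸_; _≤_; _<_; s≤s; z≤n; NonZero; >-nonZero; n>1⇒nonTrivial)
import Data.Nat.Properties as ℕ
open import Data.Nat.Solver using (module +-*-Solver)
open import Data.Product.Base using (_×_; _,_; ∃; proj₁; proj₂; uncurry)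
open import Data.Rational.Base as ℚ using (mkℚ; _/_; ↧ₙ_)
import Data.Rational.Properties as ℚ
open import Data.Rational.Unnormalised.Base using (mkℚᵘ; *<*)
import Data.Rational.Unnormalised.Properties as ℚᵘ
open import Data.Sum.Base using (_⊎_; inj₁; inj₂)
open import Function.Base using (_∘_)
open import Function.Definitions using (Injective)
open import Relation.Binary.PropositionalEquality
  using (_≡_; refl; sym; trans; cong; cong₂; subst)
open import Relation.Nullary.Decidable using (yes; no; _×-dec_)
open import Relation.Nullary.Negation using (contradiction)

lookup-injective : ∀ {a} {A : Set a} {xs : List A} → Unique xs → Injective _≡_ _≡_ (lookup xs)
lookup-injective {xs = _ ∷ _}  _             {zero}  {zero}  _  = refl
lookup-injective {xs = _ ∷ xs} (x∉xs ∷ _)    {zero}  {suc j} eq =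
  contradiction eq (All.lookup x∉xs (∈-lookup {xs = xs} j))
lookup-injective {xs = _ ∷ xs} (x∉xs ∷ _)    {suc i} {zero}  eq =
  contradiction (sym eq) (All.lookup x∉xs (∈-lookup {xs = xs} i))
lookup-injective {xs = _ ∷ _}  (_ ∷ unique)  {suc i} {suc j} eq =
  cong suc (lookup-injective unique eq)

-- Choosing for each position of `xs` an index that `g` maps to its entry is injective: `g` recovers
-- the entry, and distinct positions hold distinct entries.
length≤-covered : ∀ {a} {A : Set a} {xs : List A} {n} → Unique xs →
                  (g : Fin n → A) → (∀ {x} → x ∈ xs → ∃ λ i → g i ≡ x) →
                  length xs ≤ n
length≤-covered {xs = xs} unique g cover = Fin.injective⇒≤ index-injective
  where
  index : Fin (length xs) → Fin _
  index i = proj₁ (cover (∈-lookup {xs = xs} i))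

  g∘index : ∀ i → g (index i) ≡ lookup xs i
  g∘index i = proj₂ (cover (∈-lookup {xs = xs} i))

  index-injective : Injective _≡_ _≡_ index
  index-injective {i} {j} eq =
    lookup-injective unique (trans (sym (g∘index i)) (trans (cong g eq) (g∘index j)))

-- An orientation of the edges with out-degree at most d; the out-neighbour
-- lists may repeat vertices or contain non-neighbours.
record Orientation (g : Graph) (d : ℕ) : Set where
  open Graph g
  field
    out    : Fin order → Fin d → Fin order
    covers : ∀ {u v} → Adj u v → (∃ λ i → out u i ≡ v) ⊎ (∃ λ i → out v i ≡ u)

-- Brings an arc, whichever way it points, into the form in which `size` counts its edge.
sortPair : ∀ {n} → Fin n → Fin n → Fin n × Fin n
sortPair i j with i Fin.<? j
... | yes _ = i , j
... | no  _ = j , i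

sortPair-< : ∀ {n} {i j : Fin n} → i Fin.< j → sortPair i j ≡ (i , j)
sortPair-< {i = i} {j} i<j with i Fin.<? j
... | yes _   = refl
... | no  i≮j = contradiction i<j i≮j

sortPair-> : ∀ {n} {i j : Fin n} → i Fin.< j → sortPair j i ≡ (i , j)
sortPair-> {i = i} {j} i<j with j Fin.<? i
... | yes j<i = contradiction i<j (ℕ.<-asym j<i)
... | no  _   = refl

-- There are `order * d` arcs `(u , k)`, and each edge is the sorted form of at least one. Arcs that
-- are repeated or are not edges only weaken the bound.
size≤order*degree : ∀ {g d} → Orientation g d → Graph.size g ≤ Graph.order g * d
size≤order*degree {g} {d} o = length≤-covered unique (arc ∘ remQuot d) cover
  where
  open Graph g
  open Orientation o

  isEdge? = λ ((i , j) : Fin order × Fin order) → (i Fin.<? j) ×-dec adj? i j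
  pairs = cartesianProduct (allFin order) (allFin order)

  unique : Unique (filter isEdge? pairs)
  unique = Unique.filter⁺ isEdge?
    (Unique.cartesianProduct⁺ (Unique.allFin⁺ order) (Unique.allFin⁺ order))

  arc : Fin order × Fin d → Fin order × Fin order
  arc (u , k) = sortPair u (out u k)

  cover : ∀ {e} → e ∈ filter isEdge? pairs → ∃ λ x → arc (remQuot d x) ≡ e
  cover {i , j} e∈ with ∈-filter⁻ isEdge? {xs = pairs} e∈
  ... | _ , i<j , ij with covers ij
  ...   | inj₁ (k , refl) = combine i k , trans (cong arc (Fin.remQuot-combine i k)) (sortPair-< i<j)
  ...   | inj₂ (k , refl) = combine j k , trans (cong arc (Fin.remQuot-combine j k)) (sortPair-> i<j)

triangle-orientation : Orientation (HubGraph.graph triangle) 1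
triangle-orientation = record { out = λ u _ → next u ; covers = covers _ _ }
  where
  next : Fin 3 → Fin 3
  next zero             = suc zero
  next (suc zero)       = suc (suc zero)
  next (suc (suc zero)) = zero

  covers : ∀ u v → Graph.Adj (HubGraph.graph triangle) u v →
           (∃ λ (_ : Fin 1) → next u ≡ v) ⊎ (∃ λ (_ : Fin 1) → next v ≡ u)
  covers zero             zero             u≢v = contradiction refl u≢v
  covers zero             (suc zero)       _   = inj₁ (zero , refl)
  covers zero             (suc (suc zero)) _   = inj₂ (zero , refl)
  covers (suc zero)       zero             _   = inj₂ (zero , refl)
  covers (suc zero)       (suc zero)       u≢v = contradiction refl u≢v
  covers (suc zero)       (suc (suc zero)) _   = inj₁ (zero , refl)
  covers (suc (suc zero)) zero             _   = inj₁ (zero , refl)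
  covers (suc (suc zero)) (suc zero)       _   = inj₂ (zero , refl)
  covers (suc (suc zero)) (suc (suc zero)) u≢v = contradiction refl u≢v

-- Each copy keeps its arcs, and index `zero` becomes an arc to the original hub. Only the bottom
-- nodes of replicas need the new arc; giving it to every vertex keeps the out-degree uniform.
step-orientation : ∀ {k d} (o : Fin k) h → Orientation (HubGraph.graph h) d →
                   Orientation (HubGraph.graph (step k o h)) (suc d)
step-orientation {k} {d} o h orient = record { out = out′ ∘ vertex ; covers = covers′ _ _ }
  where
  open HubGraph h
  open Step k o h using (Copies; StepAdj; vertex)
  open Orientation orient

  out′ : Copies → Fin (suc d) → Fin (k * order)
  out′ _       zero    = combine o root
  out′ (c , u) (suc i) = combine c (out u i)

  combine-vertex : ∀ x {p} → vertex x ≡ p → uncurry combine p ≡ x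
  combine-vertex x eq = trans (cong (uncurry combine) (sym eq)) (Fin.combine-remQuot {k} order x)

  covers′ : ∀ x y → StepAdj (vertex x) (vertex y) →
            (∃ λ i → out′ (vertex x) i ≡ y) ⊎ (∃ λ i → out′ (vertex y) i ≡ x)
  covers′ x y (inj₂ (inj₁ ((c≡o , u≡root) , _))) =
    inj₂ (zero , combine-vertex x (cong₂ _,_ c≡o u≡root))
  covers′ x y (inj₂ (inj₂ ((c≡o , u≡root) , _))) =
    inj₁ (zero , combine-vertex y (cong₂ _,_ c≡o u≡root))
  covers′ x y (inj₁ (c≡d , uv)) with covers uv
  ... | inj₁ (i , eq) = inj₁ (suc i , combine-vertex y (sym (cong₂ _,_ c≡d eq)))
  ... | inj₂ (i , eq) = inj₂ (suc i , combine-vertex x (cong₂ _,_ c≡d (sym eq)))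

module _ {z : ℕ} (z>2 : z > 2) where

  G-orientation : ∀ t → Orientation (HubGraph.graph (G z>2 t)) (suc t)
  G-orientation zero    = triangle-orientation
  G-orientation (suc t) = step-orientation (fromℕ< (z>0 z>2)) (G z>2 t) (G-orientation t)

  order-superquadratic : ∀ t → 2 * (suc t * t) + 2 ≤ HubGraph.order (G z>2 t)
  order-superquadratic zero    = s≤s (s≤s z≤n)
  order-superquadratic (suc t) = begin
    -- The slack `4 * (t * t)` is exactly the amount by which three times the bound at `t` exceeds
    -- the bound at `suc t`.
    2 * (suc (suc t) * suc t) + 2                  ≤⟨ ℕ.m≤m+n _ (4 * (t * t)) ⟩
    2 * (suc (suc t) * suc t) + 2 + 4 * (t * t)    ≡⟨ identity t ⟩
    3 * (2 * (suc t * t) + 2)                      ≤⟨ ℕ.*-mono-≤ z>2 (order-superquadratic t) ⟩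
    z * HubGraph.order (G z>2 t)                   ∎
    where
    open ℕ.≤-Reasoning
    open +-*-Solver
    identity : ∀ t → 2 * (suc (suc t) * suc t) + 2 + 4 * (t * t) ≡ 3 * (2 * (suc t * t) + 2)
    identity = solve 1 (λ t →
      con 2 :* ((con 2 :+ t) :* (con 1 :+ t)) :+ con 2 :+ con 4 :* (t :* t)
        := con 3 :* (con 2 :* ((con 1 :+ t) :* t) :+ con 2)) refl

  -- For positive `q` this is `ρ t < 1 / q` cleared of denominators.
  2size*q<order[order∸1] : ∀ {q t} → q ≤ t →
    let open HubGraph (G z>2 t) in 2 * size * q < order * (order ∸ 1)
  2size*q<order[order∸1] {q} {t} q≤t = begin-strict
    2 * size * q               ≤⟨ ℕ.*-mono-≤ (ℕ.*-monoʳ-≤ 2 (size≤order*degree (G-orientation t))) q≤t ⟩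
    2 * (order * suc t) * t    ≡⟨ identity order t ⟩
    order * (2 * (suc t * t))  <⟨ ℕ.*-monoʳ-< order {{order≢0}} 2[1+t]t<order∸1 ⟩
    order * (order ∸ 1)        ∎
    where
    open HubGraph (G z>2 t) using (order; size)
    open ℕ.≤-Reasoning
    open +-*-Solver
    order≢0 : NonZero order
    order≢0 = >-nonZero (ℕ.<⇒≤ (order-G>1 z>2 t))
    2[1+t]t<order∸1 : 2 * (suc t * t) < order ∸ 1
    -- Of the `+ 2` in `order-superquadratic`, one unit gives strictness and the other pays for
    -- `∸ 1`.
    2[1+t]t<order∸1 = ℕ.m+n≤o⇒m≤o∸n _
      (subst (_≤ order) (solve 1 (λ x → x :+ con 2 := con 1 :+ x :+ con 1) refl (2 * (suc t * t)))
             (order-superquadratic t))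
    identity : ∀ n t → 2 * (n * suc t) * t ≡ n * (2 * (suc t * t))
    identity = solve 2 (λ n t →
      con 2 :* (n :* (con 1 :+ t)) :* t := n :* (con 2 :* ((con 1 :+ t) :* t))) refl

0≤+/ : ∀ m n .{{_ : NonZero n}} → 0ℚ ℚ.≤ + m / n
0≤+/ m n = ℚ.nonNegative⁻¹ (+ m / n) {{ℚ.normalize-nonNeg m n}}

-- A positive rational has numerator at least 1, so it is at least the reciprocal of its
-- denominator.
/<-positive : ∀ m n .{{_ : NonZero n}} ε → ε ℚ.> 0ℚ → m * ↧ₙ ε < n → + m / n ℚ.< ε
/<-positive m (suc n-1) (mkℚ (+ zero) _ _)    (ℚ.*<* (+<+ ())) _
/<-positive m (suc n-1) ε@(mkℚ (+ suc p) q-1 _) _ mq<n =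
  -- Since `_/_` reduces to lowest terms, the comparison moves to unnormalised rationals, where it
  -- is plain cross-multiplication.
  ℚ.toℚᵘ-cancel-< (ℚᵘ.<-respˡ-≃ (ℚᵘ.≃-sym (ℚ.toℚᵘ-fromℚᵘ (mkℚᵘ (+ m) n-1)))
    (*<* (subst (ℤ._< + suc p ℤ.* + suc n-1) (ℤ.pos-* m (suc q-1))
           (+<+ (ℕ.<-≤-trans mq<n (ℕ.m≤n*m (suc n-1) (suc p)))))))

theorem3p2 : (z : ℕ) (z>2 : z > 2) → ρ z>2 ⟶ 0ℚ
-- The threshold is the denominator `q` of `ε`: for `t ≥ q` the density is below `1 / q`, hence
-- below `ε`.
theorem3p2 z z>2 ε ε>0 = ↧ₙ ε , λ t t≥q →
  let open HubGraph (G z>2 t)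
      instance n≢0 = n[n∸1]≢0 order {{n>1⇒nonTrivial (order-G>1 z>2 t)}}
  in subst (ℚ._< ε)
       (sym (trans (cong ℚ.∣_∣ (ℚ.+-identityʳ (ρ z>2 t)))
                   (ℚ.0≤p⇒∣p∣≡p (0≤+/ (2 * size) (order * (order ∸ 1))))))
       (/<-positive (2 * size) (order * (order ∸ 1)) ε ε>0 (2size*q<order[order∸1] z>2 t≥q))
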